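{- Let $\mathcal{P}$ be a convex polyomino and let $T$ be a triangulation of $\mathcal{P}$. Then $T$ is word-representable if and only if $T$ is $3$-colorable.
   Context: A polyomino is a plane figure formed by joining finitely many equal unit squares edge to edge. It is regarded as a graph whose vertices are the corners of its squares and whose edges are the sides of its squares. A polyomino is column convex if its intersection with every vertical line is convex (connected), row convex if its intersection with every horizontal line is convex, and convex if it is both. A triangulation of a polyomino is the graph obtained from the polyomino's graph by adding, in each unit square of the polyomino, exactly one of its two diagonals as an edge. A graph $G=(V,E)$ is word-representable if there is a word $w$ over the alphabet $V$ such that for all distinct $x,y\in V$, the letters $x$ and $y$ alternate in $w$ if and only if $\{x,y\}\in E$. A graph is $k$-colorable if its vertices can be colored with at most $k$ colors so that adjacent vertices receive different colors. -}

module Defs where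

open import Data.Bool using (Bool; true; false)
open import Data.Fin using (Fin)
open import Data.Integer using (ℤ; _+_; _≤_; 1ℤ)
open import Data.Integer.Properties using () renaming (_≟_ to _≟ℤ_)
open import Data.List using (List; []; _∷_; filter)
open import Data.List.Membership.Propositional using (_∈_)
open import Data.List.Relation.Unary.All using (All)
open import Data.Product using (_×_; _,_; ∃; ∃-syntax; Σ-syntax)
open import Data.Product.Properties using (≡-dec)
open import Data.Sum using (_⊎_)
open import Function.Bundles using (_⇔_)
open import Relation.Binary.PropositionalEquality using (_≡_; _≢_)
open import Relation.Binary.Definitions using (DecidableEquality)
open import Relation.Nullary.Decidable using (_⊎-dec_)

-- A unit cell is named by the lattice point of its lower-left corner:
-- cell (i , j) is the square [i, i+1] × [j, j+1].
Cell : Set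
Cell = ℤ × ℤ

Point : Set
Point = ℤ × ℤ

_≟P_ : DecidableEquality Point
_≟P_ = ≡-dec _≟ℤ_ _≟ℤ_

data CellAdj : Cell → Cell → Set where
  right : ∀ {i j} → CellAdj (i , j) (i + 1ℤ , j)
  left  : ∀ {i j} → CellAdj (i + 1ℤ , j) (i , j)
  up    : ∀ {i j} → CellAdj (i , j) (i , j + 1ℤ)
  down  : ∀ {i j} → CellAdj (i , j + 1ℤ) (i , j)

data Reach (cs : List Cell) (c : Cell) : Cell → Set where
  here : c ∈ cs → Reach cs c c
  step : ∀ {c' c''} → Reach cs c c' → c'' ∈ cs → CellAdj c' c'' → Reach cs c c''

record Polyomino : Set where
  field
    cells     : List Cell
    nonempty  : ∃[ c ] (c ∈ cells)
    connected : ∀ {c c'} → c ∈ cells → c' ∈ cells → Reach cells c c'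
open Polyomino public

ColumnConvex : Polyomino → Set
ColumnConvex P = ∀ i j₁ j₂ j → (i , j₁) ∈ cells P → (i , j₂) ∈ cells P →
                 j₁ ≤ j → j ≤ j₂ → (i , j) ∈ cells P

RowConvex : Polyomino → Set
RowConvex P = ∀ j i₁ i₂ i → (i₁ , j) ∈ cells P → (i₂ , j) ∈ cells P →
              i₁ ≤ i → i ≤ i₂ → (i , j) ∈ cells P

Convex : Polyomino → Set
Convex P = ColumnConvex P × RowConvex P

data Corner : Cell → Point → Set where
  ll : ∀ {i j} → Corner (i , j) (i , j)
  lr : ∀ {i j} → Corner (i , j) (i + 1ℤ , j)
  ul : ∀ {i j} → Corner (i , j) (i , j + 1ℤ)
  ur : ∀ {i j} → Corner (i , j) (i + 1ℤ , j + 1ℤ)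

IsVertex : Polyomino → Point → Set
IsVertex P v = ∃[ c ] (c ∈ cells P × Corner c v)

-- A triangulation chooses one diagonal in each cell:
--   true  : the diagonal (i , j) — (i+1 , j+1)
--   false : the diagonal (i+1 , j) — (i , j+1)
-- (only the values on cells of the polyomino matter)
Triangulation : Set
Triangulation = Cell → Bool

data CellEdge (t : Triangulation) : Cell → Point → Point → Set where
  bottom  : ∀ {i j} → CellEdge t (i , j) (i , j) (i + 1ℤ , j)
  bottom' : ∀ {i j} → CellEdge t (i , j) (i + 1ℤ , j) (i , j)
  top     : ∀ {i j} → CellEdge t (i , j) (i , j + 1ℤ) (i + 1ℤ , j + 1ℤ)
  top'    : ∀ {i j} → CellEdge t (i , j) (i + 1ℤ , j + 1ℤ) (i , j + 1ℤ)
  lside   : ∀ {i j} → CellEdge t (i , j) (i , j) (i , j + 1ℤ)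
  lside'  : ∀ {i j} → CellEdge t (i , j) (i , j + 1ℤ) (i , j)
  rside   : ∀ {i j} → CellEdge t (i , j) (i + 1ℤ , j) (i + 1ℤ , j + 1ℤ)
  rside'  : ∀ {i j} → CellEdge t (i , j) (i + 1ℤ , j + 1ℤ) (i + 1ℤ , j)
  diag    : ∀ {i j} → t (i , j) ≡ true →
            CellEdge t (i , j) (i , j) (i + 1ℤ , j + 1ℤ)
  diag'   : ∀ {i j} → t (i , j) ≡ true →
            CellEdge t (i , j) (i + 1ℤ , j + 1ℤ) (i , j)
  anti    : ∀ {i j} → t (i , j) ≡ false →
            CellEdge t (i , j) (i + 1ℤ , j) (i , j + 1ℤ)
  anti'   : ∀ {i j} → t (i , j) ≡ false →
            CellEdge t (i , j) (i , j + 1ℤ) (i + 1ℤ , j)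

Adj : Polyomino → Triangulation → Point → Point → Set
Adj P t u v = ∃[ c ] (c ∈ cells P × CellEdge t c u v)

data NoRepeat {A : Set} : List A → Set where
  []  : NoRepeat []
  [_] : ∀ x → NoRepeat (x ∷ [])
  _∷_ : ∀ {x y l} → x ≢ y → NoRepeat (y ∷ l) → NoRepeat (x ∷ y ∷ l)

restrict : List Point → Point → Point → List Point
restrict w x y = filter (λ z → (z ≟P x) ⊎-dec (z ≟P y)) w

-- x and y alternate in w: deleting all other letters leaves xyxy… or yxyx…
Alternate : List Point → Point → Point → Set
Alternate w x y = NoRepeat (restrict w x y)

Represents : Polyomino → Triangulation → List Point → Set
Represents P t w =
  All (IsVertex P) w ×
  (∀ v → IsVertex P v → v ∈ w) ×
  (∀ x y → IsVertex P x → IsVertex P y → x ≢ y →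
     (Alternate w x y ⇔ Adj P t x y))

WordRepresentable : Polyomino → Triangulation → Set
WordRepresentable P t = ∃[ w ] Represents P t w

ThreeColorable : Polyomino → Triangulation → Set
ThreeColorable P t =
  Σ[ f ∈ (Point → Fin 3) ] (∀ u v → Adj P t u v → f u ≢ f v)

{-# OPTIONS --safe #-}
module Submission where

-- If a word represents T, cut it at an occurrence of an interior vertex v. The neighbours of
-- v all alternate with v, and reading on from the cut orients the edges between them
-- transitively. So along the link of v, an induced cycle, every vertex is a source or a sink;
-- the link has even length, which says that the four cells around v carry an even number of
-- diagonals of each type. By convexity this makes the type of the diagonal of cell (i , j) a
-- comparison of a sign a(i) with a sign b(j), and adding up these signs modulo 3 along the two
-- axes gives a proper colouring.
--
-- Conversely every 3-colourable graph is word-representable: concatenate, over all vertices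
-- x, a word in which every edge from a lower to a higher colour a, b reads abab, while x fails
-- to alternate with its non-neighbours of its own and of the cyclically next colour.

open import Defs
import Data.Integer.Properties as ℤ
import Data.Nat.Properties as ℕ
open import Data.Product.Properties using (≡-dec)
open import Algebra.Properties.AbelianGroup ℤ.+-0-abelianGroup using (identityʳ-unique; xyx⁻¹≈y)
open import Data.Bool using (Bool; true; false; not; _xor_; if_then_else_; T; T?)
open import Data.Bool.Properties using (xor-assoc; xor-comm; xor-same; xor-identityʳ; not-involutive)
open import Data.Bool.Solver using (module xor-∧-Solver)
open import Data.Empty using (⊥)
open import Data.Fin using (Fin; _<_; _<?_) renaming (_≟_ to _≟ᶠ_)
open import Data.Fin.Patterns using (0F; 1F; 2F)
open import Data.Fin.Properties using (all?; <-cmp)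
open import Data.Integer using (ℤ; +_; -[1+_]; _+_; _-_; _≤_; 0ℤ; 1ℤ; ∣_∣)
open import Data.List using (List; []; _∷_; _++_; _ʳ++_; map; filter; concatMap; deduplicate)
open import Data.List.Membership.DecPropositional _≟P_ using (_∈?_)
open import Data.List.Membership.DecPropositional (≡-dec _≟P_ _≟P_) using () renaming (_∈?_ to _∈ᵉ?_)
open import Data.List.Membership.Propositional using (_∈_; find; lose)
open import Data.List.Membership.Propositional.Properties using (∈-∃++; ∈-filter⁺; ∈-filter⁻; ∈-concatMap⁺; ∈-concatMap⁻; ∈-deduplicate⁺; ∈-deduplicate⁻)
open import Data.List.Properties using (filter-++; filter-none; filter-accept; filter-reject; filter-≐; concatMap-++; ʳ++-ʳ++)
import Data.List.Relation.Unary.All as All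
open import Data.List.Relation.Unary.AllPairs using (_∷_)
open import Data.List.Relation.Unary.Any using (any?; here; there)
open import Data.List.Relation.Unary.Unique.DecPropositional.Properties _≟P_ using (deduplicate-!)
open import Data.List.Relation.Unary.Unique.Propositional using (Unique)
open import Data.List.Relation.Unary.Unique.Propositional.Properties using (filter⁺)
open import Data.Nat using (ℕ; zero; suc)
open import Data.Product using (_×_; _,_; ∃-syntax; proj₁; proj₂; swap)
open import Data.Sum using (_⊎_; inj₁; inj₂; [_,_]′) renaming (swap to ⊎-swap; map to ⊎-map)
open import Data.Unit using (⊤; tt)
open import Function using (_∘_; id)
open import Function.Bundles using (_⇔_; mk⇔; Equivalence)
open import Relation.Binary.Definitions using (tri<; tri≈; tri>)
open import Relation.Binary.PropositionalEquality using (_≡_; _≢_; refl; sym; trans; cong; cong₂; subst; subst₂; ≢-sym; module ≡-Reasoning)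
open import Relation.Nullary using (¬_; Dec; yes; no; contradiction)
open import Relation.Nullary.Decidable using (_×-dec_; _⊎-dec_; _→-dec_; map′; toWitness)
open import Relation.Unary using (Decidable)

-- Alternation of two letters as an inductive predicate

-- Alt x y w: deleting the letters other than x and y from w leaves a prefix of xyxy….
data Alt : Point → Point → List Point → Set where
  []   : ∀ {x y} → Alt x y []
  hit  : ∀ {x y w} → Alt y x w → Alt x y (x ∷ w)
  skip : ∀ {x y a w} → a ≢ x → a ≢ y → Alt x y w → Alt x y (a ∷ w)

Alt-hit⁻ : ∀ {x y w} → Alt x y (x ∷ w) → Alt y x w
Alt-hit⁻ (hit p)        = p
Alt-hit⁻ (skip x≢x _ _) = contradiction refl x≢x

Alt-skip⁻ : ∀ {x y a w} → a ≢ x → Alt x y (a ∷ w) → Alt x y w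
Alt-skip⁻ a≢x (hit _)      = contradiction refl a≢x
Alt-skip⁻ a≢x (skip _ _ p) = p

Alt-block : ∀ {x y w} → x ≢ y → ¬ Alt x y (y ∷ w)
Alt-block x≢y (hit _)        = x≢y refl
Alt-block x≢y (skip _ y≢y _) = y≢y refl

restrict-sym : ∀ w x y → restrict w x y ≡ restrict w y x
restrict-sym w x y = filter-≐ _ _ (⊎-swap , ⊎-swap) w

NoRepeat-tail : ∀ {A : Set} {x : A} {l} → NoRepeat (x ∷ l) → NoRepeat l
NoRepeat-tail [ _ ]    = []
NoRepeat-tail (_ ∷ nr) = nr

-- The letter y in front stands for the last letter read, so that x is due next.
NoRepeat⇒Alt : ∀ w {x y} → NoRepeat (y ∷ restrict w x y) → Alt x y w
NoRepeat⇒Alt []      nr = []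
NoRepeat⇒Alt (a ∷ w) {x} {y} nr with a ≟P x | a ≟P y
... | yes refl | _ with _ ∷ nr′ ← nr = hit (NoRepeat⇒Alt w (subst (NoRepeat ∘ (a ∷_)) (restrict-sym w a y) nr′))
... | no a≢x | yes refl with y≢y ∷ _ ← nr = contradiction refl y≢y
... | no a≢x | no a≢y  = skip a≢x a≢y (NoRepeat⇒Alt w nr)

Alt⇒NoRepeat : ∀ {x y w} → x ≢ y → Alt x y w → NoRepeat (y ∷ restrict w x y)
Alt⇒NoRepeat x≢y [] = [ _ ]
Alt⇒NoRepeat {x} {y} {_ ∷ w} x≢y (hit p)
  with x ≟P x
... | no x≢x = contradiction refl x≢x
... | yes _ rewrite restrict-sym w x y = ≢-sym x≢y ∷ Alt⇒NoRepeat (≢-sym x≢y) p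
Alt⇒NoRepeat {x} {y} {a ∷ w} x≢y (skip a≢x a≢y p) with a ≟P x | a ≟P y
... | yes a≡x | _       = contradiction a≡x a≢x
... | no _    | yes a≡y = contradiction a≡y a≢y
... | no _    | no _    = Alt⇒NoRepeat x≢y p

Alternate⇒Alt : ∀ w {x y} → x ≢ y → Alternate w x y → Alt x y w ⊎ Alt y x w
Alternate⇒Alt []      x≢y nr = inj₁ []
Alternate⇒Alt (a ∷ w) {x} {y} x≢y nr with a ≟P x | a ≟P y
... | yes refl | _ = inj₁ (hit (NoRepeat⇒Alt w (subst (NoRepeat ∘ (a ∷_)) (restrict-sym w a y) nr)))
... | no a≢x | yes refl = inj₂ (hit (NoRepeat⇒Alt w nr))
... | no a≢x | no a≢y with Alternate⇒Alt w x≢y nr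
...   | inj₁ p = inj₁ (skip a≢x a≢y p)
...   | inj₂ p = inj₂ (skip a≢y a≢x p)

Alt⇒Alternate : ∀ {w x y} → x ≢ y → Alt x y w ⊎ Alt y x w → Alternate w x y
Alt⇒Alternate x≢y (inj₁ p) = NoRepeat-tail (Alt⇒NoRepeat x≢y p)
Alt⇒Alternate {w} {x} {y} x≢y (inj₂ p) =
  subst NoRepeat (restrict-sym w y x) (NoRepeat-tail (Alt⇒NoRepeat (≢-sym x≢y) p))

-- The word reads p q r s p q r s …; each letter p read rotates the four roles.
Alt-cycle : ∀ {p q r s} w → p ≢ q → p ≢ r → p ≢ s → q ≢ r → q ≢ s → r ≢ s →
            Alt p q w → Alt q r w → Alt r s w → Alt p s w → Alt p r w × Alt q s w
Alt-cycle []      _ _ _ _ _ _ _ _ _ _ = [] , []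
Alt-cycle {p} {q} {r} {s} (a ∷ w) pq pr ps qr qs rs Apq Aqr Ars Aps
  with a ≟P p | a ≟P q | a ≟P r | a ≟P s
... | yes refl | _ | _ | _ =
      let Aqs , Arp = Alt-cycle w qr qs (≢-sym pq) rs (≢-sym pr) (≢-sym ps)
                        (Alt-skip⁻ pq Aqr) (Alt-skip⁻ pr Ars) (Alt-hit⁻ Aps) (Alt-hit⁻ Apq)
      in hit Arp , skip pq ps Aqs
... | no _ | yes refl | _ | _ = contradiction Apq (Alt-block pq)
... | no _ | no _ | yes refl | _ = contradiction Aqr (Alt-block qr)
... | no _ | no _ | no _ | yes refl = contradiction Ars (Alt-block rs)
... | no a≢p | no a≢q | no a≢r | no a≢s =
      let Apr , Aqs = Alt-cycle w pq pr ps qr qs rs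
                        (Alt-skip⁻ a≢p Apq) (Alt-skip⁻ a≢q Aqr) (Alt-skip⁻ a≢r Ars) (Alt-skip⁻ a≢p Aps)
      in skip a≢p a≢r Apr , skip a≢q a≢s Aqs

-- The word l ʳ++ r, seen from the gap between its two parts: the next of the two letters
-- to the right of the gap is x, and the next one to the left is y.
AltAt : List Point → List Point → Point → Point → Set
AltAt l r x y = Alt x y r × Alt y x l

-- Passing over x or y exchanges the letter due on each side; any other letter changes nothing.
AltAt-move : ∀ {l r a x y} → x ≢ y → AltAt l (a ∷ r) x y → AltAt (a ∷ l) r x y ⊎ AltAt (a ∷ l) r y x
AltAt-move x≢y (hit p , q)            = inj₂ (p , hit q)
AltAt-move x≢y (skip a≢x a≢y p , q) = inj₁ (p , skip a≢y a≢x q)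

-- Which of x and y is due first at the new gap depends on how many of them u contains, hence the
-- disjunctions.
AltAt-open : ∀ u {l r x y} → x ≢ y → AltAt l (u ++ r) x y ⊎ AltAt l (u ++ r) y x →
             AltAt (u ʳ++ l) r x y ⊎ AltAt (u ʳ++ l) r y x
AltAt-open []      x≢y d = d
AltAt-open (a ∷ u) x≢y d =
  AltAt-open u x≢y ([ AltAt-move x≢y , ⊎-swap ∘ AltAt-move (≢-sym x≢y) ]′ d)

AltAt-close : ∀ l {r x y} → x ≢ y → AltAt l r x y ⊎ AltAt l r y x →
              Alt x y (l ʳ++ r) ⊎ Alt y x (l ʳ++ r)
AltAt-close []      x≢y (inj₁ (p , _)) = inj₁ p
AltAt-close []      x≢y (inj₂ (p , _)) = inj₂ p
AltAt-close (a ∷ l) x≢y d = AltAt-close l x≢y ([ back x≢y , ⊎-swap ∘ back (≢-sym x≢y) ]′ d)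
  where
  back : ∀ {l r a x y} → x ≢ y → AltAt (a ∷ l) r x y → AltAt l (a ∷ r) x y ⊎ AltAt l (a ∷ r) y x
  -- Exchanging the two sides of the gap turns a move to the left into a move to the right.
  back x≢y (p , q) = [ inj₁ ∘ swap , inj₂ ∘ swap ]′ (AltAt-move (≢-sym x≢y) (q , p))

-- Edges and non-edges of the triangulation by coordinates

i≢i+k : ∀ i k → k ≢ 0ℤ → i ≢ i + k
i≢i+k i k k≢0 i≡i+k = k≢0 (identityʳ-unique i k (sym i≡i+k))

i≢i+1 : ∀ i → i ≢ i + 1ℤ
i≢i+1 i = i≢i+k i 1ℤ λ ()

i≢i+1+1 : ∀ i → i ≢ i + 1ℤ + 1ℤ
i≢i+1+1 i eq = i≢i+k i (+ 2) (λ ()) (trans eq (ℤ.+-assoc i 1ℤ 1ℤ))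

i≢i+1+1+1 : ∀ i → i ≢ i + 1ℤ + 1ℤ + 1ℤ
i≢i+1+1+1 i eq = i≢i+k i (+ 3) (λ ())
  (trans eq (trans (ℤ.+-assoc (i + 1ℤ) 1ℤ 1ℤ) (ℤ.+-assoc i 1ℤ (+ 2))))

Near : ℤ → ℤ → Set
Near p q = p ≡ q ⊎ q ≡ p + 1ℤ ⊎ p ≡ q + 1ℤ

¬Near-2 : ∀ p → ¬ Near p (p + 1ℤ + 1ℤ)
¬Near-2 p (inj₁ eq)        = i≢i+1+1 p eq
¬Near-2 p (inj₂ (inj₁ eq)) = i≢i+1 (p + 1ℤ) (sym eq)
¬Near-2 p (inj₂ (inj₂ eq)) = i≢i+1+1+1 p eq

pattern same = inj₁ refl
pattern succ = inj₂ (inj₁ refl)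
pattern pred = inj₂ (inj₂ refl)

module _ {t : Triangulation} where

  CellEdge-near : ∀ {c u v} → CellEdge t c u v → Near (proj₁ u) (proj₁ v) × Near (proj₂ u) (proj₂ v)
  CellEdge-near bottom    = succ , same
  CellEdge-near bottom'   = pred , same
  CellEdge-near top       = succ , same
  CellEdge-near top'      = pred , same
  CellEdge-near lside     = same , succ
  CellEdge-near lside'    = same , pred
  CellEdge-near rside     = same , succ
  CellEdge-near rside'    = same , pred
  CellEdge-near (diag _)  = succ , succ
  CellEdge-near (diag' _) = pred , pred
  CellEdge-near (anti _)  = pred , succ
  CellEdge-near (anti' _) = succ , pred

  CellEdge-sym : ∀ {c u v} → CellEdge t c u v → CellEdge t c v u
  CellEdge-sym bottom    = bottom'
  CellEdge-sym bottom'   = bottom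
  CellEdge-sym top       = top'
  CellEdge-sym top'      = top
  CellEdge-sym lside     = lside'
  CellEdge-sym lside'    = lside
  CellEdge-sym rside     = rside'
  CellEdge-sym rside'    = rside
  CellEdge-sym (diag e)  = diag' e
  CellEdge-sym (diag' e) = diag e
  CellEdge-sym (anti e)  = anti' e
  CellEdge-sym (anti' e) = anti e

  CellEdge-corner : ∀ {c u v} → CellEdge t c u v → Corner c u
  CellEdge-corner bottom    = ll
  CellEdge-corner bottom'   = lr
  CellEdge-corner top       = ul
  CellEdge-corner top'      = ur
  CellEdge-corner lside     = ll
  CellEdge-corner lside'    = ul
  CellEdge-corner rside     = lr
  CellEdge-corner rside'    = ur
  CellEdge-corner (diag _)  = ll
  CellEdge-corner (diag' _) = ur
  CellEdge-corner (anti _)  = lr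
  CellEdge-corner (anti' _) = ul

  CellEdge-irrefl : ∀ {c u v} → CellEdge t c u v → u ≢ v
  CellEdge-irrefl bottom    eq = i≢i+1 _ (cong proj₁ eq)
  CellEdge-irrefl bottom'   eq = i≢i+1 _ (cong proj₁ (sym eq))
  CellEdge-irrefl top       eq = i≢i+1 _ (cong proj₁ eq)
  CellEdge-irrefl top'      eq = i≢i+1 _ (cong proj₁ (sym eq))
  CellEdge-irrefl lside     eq = i≢i+1 _ (cong proj₂ eq)
  CellEdge-irrefl lside'    eq = i≢i+1 _ (cong proj₂ (sym eq))
  CellEdge-irrefl rside     eq = i≢i+1 _ (cong proj₂ eq)
  CellEdge-irrefl rside'    eq = i≢i+1 _ (cong proj₂ (sym eq))
  CellEdge-irrefl (diag _)  eq = i≢i+1 _ (cong proj₁ eq)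
  CellEdge-irrefl (diag' _) eq = i≢i+1 _ (cong proj₁ (sym eq))
  CellEdge-irrefl (anti _)  eq = i≢i+1 _ (cong proj₁ (sym eq))
  CellEdge-irrefl (anti' _) eq = i≢i+1 _ (cong proj₁ eq)

  -- The cell c is not given: the end points alone identify it. They enter through equations because
  -- unification cannot solve for the summands of `p + 1ℤ`.
  CellEdge-diag : ∀ {c u v p q} → CellEdge t c u v → u ≡ (p , q) → v ≡ (p + 1ℤ , q + 1ℤ) → t (p , q) ≡ true
  CellEdge-diag bottom    refl eq = contradiction (cong proj₂ eq) (i≢i+1 _)
  CellEdge-diag bottom'   refl eq = contradiction (cong proj₁ eq) (i≢i+1+1 _)
  CellEdge-diag top       refl eq = contradiction (cong proj₂ eq) (i≢i+1 _)
  CellEdge-diag top'      refl eq = contradiction (cong proj₁ eq) (i≢i+1+1 _)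
  CellEdge-diag lside     refl eq = contradiction (cong proj₁ eq) (i≢i+1 _)
  CellEdge-diag lside'    refl eq = contradiction (cong proj₂ eq) (i≢i+1+1 _)
  CellEdge-diag rside     refl eq = contradiction (cong proj₁ eq) (i≢i+1 _)
  CellEdge-diag rside'    refl eq = contradiction (cong proj₂ eq) (i≢i+1+1 _)
  CellEdge-diag (diag e)  refl eq = e
  CellEdge-diag (diag' _) refl eq = contradiction (cong proj₁ eq) (i≢i+1+1 _)
  CellEdge-diag (anti _)  refl eq = contradiction (cong proj₁ eq) (i≢i+1+1 _)
  CellEdge-diag (anti' _) refl eq = contradiction (cong proj₂ eq) (i≢i+1+1 _)

  CellEdge-anti : ∀ {c u v p q} → CellEdge t c u v → (p + 1ℤ , q) ≡ u → (p , q + 1ℤ) ≡ v → t (p , q) ≡ false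
  CellEdge-anti bottom    refl eq = contradiction (cong proj₁ eq) (i≢i+1+1 _)
  CellEdge-anti bottom'   e₁   eq = contradiction (trans (cong proj₂ e₁) (sym (cong proj₂ eq))) (i≢i+1 _)
  CellEdge-anti top       refl eq = contradiction (cong proj₁ eq) (i≢i+1+1 _)
  CellEdge-anti top'      e₁   eq = contradiction (trans (cong proj₂ e₁) (sym (cong proj₂ eq))) (i≢i+1 _)
  CellEdge-anti lside     refl eq = contradiction (cong proj₁ eq) (i≢i+1 _)
  CellEdge-anti lside'    refl eq = contradiction (cong proj₁ eq) (i≢i+1 _)
  CellEdge-anti rside     e₁   eq = contradiction (trans (cong proj₁ eq) (sym (cong proj₁ e₁))) (i≢i+1 _)
  CellEdge-anti rside'    e₁   eq = contradiction (trans (cong proj₁ eq) (sym (cong proj₁ e₁))) (i≢i+1 _)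
  CellEdge-anti (diag _)  refl eq = contradiction (cong proj₁ eq) (i≢i+1+1 _)
  CellEdge-anti (diag' _) e₁   refl = contradiction (cong proj₂ e₁) (i≢i+1+1 _)
  CellEdge-anti (anti e)  e₁   eq with refl ← cong proj₁ eq | refl ← cong proj₂ e₁ = e
  CellEdge-anti (anti' _) refl eq = contradiction (cong proj₁ eq) (i≢i+1+1 _)

module Adjacency (P : Polyomino) (t : Triangulation) where

  Adj-sym : ∀ {u v} → Adj P t u v → Adj P t v u
  Adj-sym (c , c∈P , e) = c , c∈P , CellEdge-sym e

  Adj-irrefl : ∀ {u v} → Adj P t u v → u ≢ v
  Adj-irrefl (_ , _ , e) = CellEdge-irrefl e

  Adj-vertex : ∀ {u v} → Adj P t u v → IsVertex P u
  Adj-vertex (c , c∈P , e) = c , c∈P , CellEdge-corner e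

  Apart : Point → Point → Set
  Apart u v = u ≢ v × ¬ Adj P t u v

  Apart-sym : ∀ {u v} → Apart u v → Apart v u
  Apart-sym (u≢v , ¬uv) = ≢-sym u≢v , ¬uv ∘ Adj-sym

  Apart-x : ∀ {u v} → proj₁ v ≡ proj₁ u + 1ℤ + 1ℤ → Apart u v
  Apart-x refl = (λ eq → i≢i+1+1 _ (cong proj₁ eq)) , λ (_ , _ , e) → ¬Near-2 _ (proj₁ (CellEdge-near e))

  Apart-y : ∀ {u v} → proj₂ v ≡ proj₂ u + 1ℤ + 1ℤ → Apart u v
  Apart-y refl = (λ eq → i≢i+1+1 _ (cong proj₂ eq)) , λ (_ , _ , e) → ¬Near-2 _ (proj₂ (CellEdge-near e))

  Apart-diag : ∀ {p q} → t (p , q) ≡ false → Apart (p , q) (p + 1ℤ , q + 1ℤ)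
  Apart-diag tf = (λ eq → i≢i+1 _ (cong proj₁ eq)) ,
    λ (_ , _ , e) → contradiction (trans (sym (CellEdge-diag e refl refl)) tf) λ ()

  Apart-anti : ∀ {p q} → t (p , q) ≡ true → Apart (p + 1ℤ , q) (p , q + 1ℤ)
  Apart-anti t≡true = (λ eq → i≢i+1 _ (cong proj₁ (sym eq))) ,
    λ (_ , _ , e) → contradiction (trans (sym t≡true) (CellEdge-anti e refl refl)) λ ()

-- Orientation of the link of a vertex

-- The neighbours of the hub, a letter singled out at one of its occurrences in the word,
-- are ordered by AltAt there; on an induced path the order turns at every inner vertex.
module Hub {P t ys zs} {hub : Point} (rep : Represents P t (ys ++ hub ∷ zs)) where

  open Adjacency P t

  w l : List Point
  w = ys ++ hub ∷ zs
  l = ys ʳ++ []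

  _⟶_ : Point → Point → Set
  _⟶_ = AltAt l zs

  record Rim (x y : Point) : Set where
    constructor rim
    field
      spokeˡ : Adj P t hub x
      spokeʳ : Adj P t hub y
      side   : Adj P t x y

  -- An edge alternates in the whole word, so the gap can be moved to just before the hub.
  opened : ∀ {x y} → Adj P t x y → AltAt l (hub ∷ zs) x y ⊎ AltAt l (hub ∷ zs) y x
  opened {x} {y} xy = AltAt-open ys x≢y
    (⊎-map (_, []) (_, []) (Alternate⇒Alt w x≢y
      (Equivalence.from (proj₂ (proj₂ rep) x y (Adj-vertex xy) (Adj-vertex (Adj-sym xy)) x≢y) xy)))
    where x≢y = Adj-irrefl xy

  -- The hub is read right after the gap, so on either side of this occurrence x must come before
  -- the next hub.
  spoke-Alt : ∀ {x} → Adj P t hub x → Alt x hub zs × Alt x hub l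
  spoke-Alt hx with opened hx
  ... | inj₁ (p , q) = Alt-hit⁻ p , q
  ... | inj₂ (p , _) = contradiction p (Alt-block (≢-sym (Adj-irrefl hx)))

  orient : ∀ {x y} → Rim x y → x ⟶ y ⊎ y ⟶ x
  orient (rim hx hy xy) =
    ⊎-map (λ (p , q) → Alt-skip⁻ (Adj-irrefl hx) p , q) (λ (p , q) → Alt-skip⁻ (Adj-irrefl hy) p , q) (opened xy)

  alternate : ∀ {x y} → x ≢ y → Adj P t hub x → Adj P t hub y → x ⟶ y → Alternate w x y
  alternate {x} {y} x≢y hx hy (p , q) =
    subst (λ u → Alternate u x y) (ʳ++-ʳ++ ys)
      (Alt⇒Alternate x≢y (AltAt-close l x≢y (inj₁ (skip (Adj-irrefl hx) (Adj-irrefl hy) p , q))))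

  -- `Alt-cycle` applies to x, y, z, hub on the right and to z, y, x, hub on the left. It makes x
  -- and z alternate at the gap, hence in the word, which forces the missing edge.
  ¬chain : ∀ {x y z} → Rim x y → Rim y z → Apart x z → x ⟶ y → ¬ y ⟶ z
  ¬chain {x} {y} {z} (rim hx hy xy) (rim _ hz yz) (x≢z , ¬xz) (xy-zs , yx-l) (yz-zs , zy-l) =
    ¬xz (Equivalence.to (proj₂ (proj₂ rep) x z (Adj-vertex (Adj-sym hx)) (Adj-vertex (Adj-sym hz)) x≢z)
      (alternate x≢z hx hz
        ( proj₁ (Alt-cycle zs x≢y x≢z x≢h y≢z y≢h z≢h xy-zs yz-zs (proj₁ (spoke-Alt hz)) (proj₁ (spoke-Alt hx)))
        , proj₁ (Alt-cycle l (≢-sym y≢z) (≢-sym x≢z) z≢h (≢-sym x≢y) y≢h x≢h zy-l yx-l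
                   (proj₂ (spoke-Alt hx)) (proj₂ (spoke-Alt hz))))))
    where
    x≢y = Adj-irrefl xy
    y≢z = Adj-irrefl yz
    x≢h = ≢-sym (Adj-irrefl hx)
    y≢h = ≢-sym (Adj-irrefl hy)
    z≢h = ≢-sym (Adj-irrefl hz)

  Rim-sym : ∀ {x y} → Rim x y → Rim y x
  Rim-sym (rim hx hy xy) = rim hy hx (Adj-sym xy)

  Directed : Bool → Point → Point → Set
  Directed true  x y = x ⟶ y
  Directed false x y = y ⟶ x

  -- If the direction persisted at y, the three vertices would form a chain with non-adjacent ends.
  turn : ∀ s {x y z} → Rim x y → Rim y z → Apart x z → Directed s x y → Directed (not s) y z
  turn true  xy yz x∤z d = [ (λ e → contradiction e (¬chain xy yz x∤z d)) , id ]′ (orient yz)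
  turn false xy yz x∤z d = [ id , (λ e → contradiction d (¬chain (Rim-sym yz) (Rim-sym xy) (Apart-sym x∤z) e)) ]′ (orient yz)

  directed : ∀ {x y} → Rim x y → ∃[ s ] Directed s x y
  directed xy = [ true ,_ , false ,_ ]′ (orient xy)

  -- The part of the link of the hub inside one cell, from x to y: it passes through the
  -- opposite corner c exactly if the diagonal of the cell ends at the hub.
  data Arc (x c y : Point) : Bool → Set where
    via    : Rim x c → Rim c y → Apart x y → Arc x c y true
    direct : Rim x y → Arc x c y false

  -- The penultimate vertex of an arc: with y it spans the edge that leads into the next arc.
  last : Bool → Point → Point → Point
  last b x c = if b then c else x

  Arc-last : ∀ {x c y b} → Arc x c y b → Rim (last b x c) y
  Arc-last (via _ cy _) = cy
  Arc-last (direct xy)  = xy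

  -- A direct arc causes one turn and an arc through the corner two, whence the summand `not b`.
  Arc-turn : ∀ {b s p x c y} → Arc x c y b → Rim p x → Apart p c → Apart p y →
             Directed s p x → Directed (s xor not b) (last b x c) y
  Arc-turn {s = s} (via xc cy x∤y) px p∤c p∤y d =
    subst (λ s′ → Directed s′ _ _) (trans (not-involutive s) (sym (xor-identityʳ s)))
      (turn (not s) xc cy x∤y (turn s px xc p∤c d))
  Arc-turn {s = s} (direct xy) px p∤c p∤y d =
    subst (λ s′ → Directed s′ _ _) (xor-comm true s) (turn s px xy p∤y d)

  -- If x ⟶ p, the next edge of the link leaves x, so p ⟶ x would extend to a chain.
  ⟶-asym : ∀ {b p x c y} → Arc x c y b → Rim p x → Apart p c → Apart p y → p ⟶ x → ¬ x ⟶ p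
  ⟶-asym (via xc _ _) px p∤c p∤y d e = ¬chain px xc p∤c d (turn false px xc p∤c e)
  ⟶-asym (direct xy)  px p∤c p∤y d e = ¬chain px xy p∤y d (turn false px xy p∤y e)

  Directed-unique : ∀ {b p x c y} → Arc x c y b → Rim p x → Apart p c → Apart p y →
                    ∀ s s′ → Directed s p x → Directed s′ p x → s ≡ s′
  Directed-unique arc px p∤c p∤y true  true  d e = refl
  Directed-unique arc px p∤c p∤y false false d e = refl
  Directed-unique arc px p∤c p∤y true  false d e = contradiction e (⟶-asym arc px p∤c p∤y d)
  Directed-unique arc px p∤c p∤y false true  d e = contradiction d (⟶-asym arc px p∤c p∤y e)

-- Parity of the diagonals around an interior vertex

quarter-turns : ∀ s a b c d → (((s xor not a) xor not (not b)) xor not c) xor not (not d) ≡ s →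
                c xor b ≡ d xor a
quarter-turns s a b c d eq = begin
  -- `:1 :+ x` evaluates to `not x`; the sum of the two states of s vanishes in the next steps.
  c xor b                       ≡⟨ solve 5 (λ s a b c d → c :+ b :=
                                     (((((s :+ (:1 :+ a)) :+ (:1 :+ (:1 :+ b))) :+ (:1 :+ c)) :+ (:1 :+ (:1 :+ d))) :+ s)
                                       :+ (d :+ a)) refl s a b c d ⟩
  (((((s xor not a) xor not (not b)) xor not c) xor not (not d)) xor s) xor (d xor a)
                                ≡⟨ cong (λ s′ → (s′ xor s) xor (d xor a)) eq ⟩
  (s xor s) xor (d xor a)       ≡⟨ cong (_xor (d xor a)) (xor-same s) ⟩
  d xor a                       ∎
  where
  open ≡-Reasoning
  open xor-∧-Solver
  :1 : ∀ {n} → Polynomial n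
  :1 = con true

module Block {P t w} (rep : Represents P t w) {i j : ℤ}
  (sw : (i , j) ∈ cells P) (se : (i + 1ℤ , j) ∈ cells P)
  (nw : (i , j + 1ℤ) ∈ cells P) (ne : (i + 1ℤ , j + 1ℤ) ∈ cells P) where

  open Adjacency P t

  centre N NE E SE S SW W NW : Point
  centre = i + 1ℤ      , j + 1ℤ
  N      = i + 1ℤ      , j + 1ℤ + 1ℤ
  NE     = i + 1ℤ + 1ℤ , j + 1ℤ + 1ℤ
  E      = i + 1ℤ + 1ℤ , j + 1ℤ
  SE     = i + 1ℤ + 1ℤ , j
  S      = i + 1ℤ      , j
  SW     = i           , j
  W      = i           , j + 1ℤ
  NW     = i           , j + 1ℤ + 1ℤ

  -- Going once around the link brings the edge into N back to its own direction, so the number of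
  -- turns is even.
  even : t (i , j) xor t (i + 1ℤ , j) ≡ t (i , j + 1ℤ) xor t (i + 1ℤ , j + 1ℤ)
  even with ys , zs , refl ← ∈-∃++ (proj₁ (proj₂ rep) centre (_ , sw , ur)) =
    let s , p⟶N = directed (Arc-last arcNW)
    -- The four bits are the diagonals of the NE, SE, SW and NW cells, in the order of the walk.
    in quarter-turns s _ _ _ _
         (Directed-unique arcNE (Arc-last arcNW) (apart-N refl) (apart-N refl) _ _ (around p⟶N) p⟶N)
    where
    open Hub {P} {t} {ys} {zs} rep

    hN : Adj P t centre N
    hN = _ , nw , rside
    hE : Adj P t centre E
    hE = _ , ne , bottom
    hS : Adj P t centre S
    hS = _ , sw , rside'
    hW : Adj P t centre W
    hW = _ , nw , bottom'

    arcNE : Arc N NE E (t (i + 1ℤ , j + 1ℤ))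
    arcNE with t (i + 1ℤ , j + 1ℤ) in eq
    ... | true  = via (rim hN (_ , ne , diag eq) (_ , ne , top)) (rim (_ , ne , diag eq) hE (_ , ne , rside'))
                      (Apart-sym (Apart-anti eq))
    ... | false = direct (rim hN hE (_ , ne , anti' eq))

    -- The centre is the upper left corner of this cell, so the diagonal ends there when `t` is
    -- `false`; likewise for the north-west cell, by its lower right corner.
    arcSE : Arc E SE S (not (t (i + 1ℤ , j)))
    arcSE with t (i + 1ℤ , j) in eq
    ... | false = via (rim hE (_ , se , anti' eq) (_ , se , rside')) (rim (_ , se , anti' eq) hS (_ , se , bottom'))
                      (Apart-sym (Apart-diag eq))
    ... | true  = direct (rim hE hS (_ , se , diag' eq))

    arcSW : Arc S SW W (t (i , j))
    arcSW with t (i , j) in eq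
    ... | true  = via (rim hS (_ , sw , diag' eq) (_ , sw , bottom')) (rim (_ , sw , diag' eq) hW (_ , sw , lside))
                      (Apart-anti eq)
    ... | false = direct (rim hS hW (_ , sw , anti eq))

    arcNW : Arc W NW N (not (t (i , j + 1ℤ)))
    arcNW with t (i , j + 1ℤ) in eq
    ... | false = via (rim hW (_ , nw , anti eq) (_ , nw , lside)) (rim (_ , nw , anti eq) hN (_ , nw , top))
                      (Apart-diag eq)
    ... | true  = direct (rim hW hN (_ , nw , diag eq))

    last-elim : ∀ (Q : Point → Set) b {x c} → Q x → Q c → Q (last b x c)
    last-elim Q true  qx qc = qc
    last-elim Q false qx qc = qx

    pN pE pS pW : Point
    pN = last (not (t (i , j + 1ℤ))) W NW
    pE = last (t (i + 1ℤ , j + 1ℤ)) N NE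
    pS = last (not (t (i + 1ℤ , j))) E SE
    pW = last (t (i , j)) S SW

    -- Both candidates for the vertex before N have abscissa i, two away from the far side of the
    -- block.
    apart-N : ∀ {z} → proj₁ z ≡ i + 1ℤ + 1ℤ → Apart pN z
    apart-N eq = last-elim (λ p → Apart p _) (not (t (i , j + 1ℤ))) (Apart-x eq) (Apart-x eq)

    apart-E : ∀ {z} → proj₂ z ≡ j → Apart pE z
    apart-E refl = last-elim (λ p → Apart p _) (t (i + 1ℤ , j + 1ℤ)) (Apart-sym (Apart-y refl)) (Apart-sym (Apart-y refl))

    apart-S : ∀ {z} → proj₁ z ≡ i → Apart pS z
    apart-S refl = last-elim (λ p → Apart p _) (not (t (i + 1ℤ , j))) (Apart-sym (Apart-x refl)) (Apart-sym (Apart-x refl))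

    apart-W : ∀ {z} → proj₂ z ≡ j + 1ℤ + 1ℤ → Apart pW z
    apart-W eq = last-elim (λ p → Apart p _) (t (i , j)) (Apart-y eq) (Apart-y eq)

    around : ∀ {s} → Directed s pN N →
             Directed ((((s xor not (t (i + 1ℤ , j + 1ℤ))) xor not (not (t (i + 1ℤ , j))))
                         xor not (t (i , j))) xor not (not (t (i , j + 1ℤ)))) pN N
    around d =
      Arc-turn arcNW (Arc-last arcSW) (apart-W refl) (apart-W refl)
        (Arc-turn arcSW (Arc-last arcSE) (apart-S refl) (apart-S refl)
          (Arc-turn arcSE (Arc-last arcNE) (apart-E refl) (apart-E refl)
            (Arc-turn arcNE (Arc-last arcNW) (apart-N refl) (apart-N refl) d)))

-- Summation along the integers and constancy on intervals

module Integral {A : Set} (step back : ℤ → A → A) (step-back : ∀ i x → step i (back i x) ≡ x) (origin : A) where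

  forth : ℕ → A
  forth zero    = origin
  forth (suc n) = step (+ n) (forth n)

  -- `under n` is the value at -(n + 1): the step that leads out of that very point is undone.
  under : ℕ → A
  under zero    = back -[1+ 0 ] origin
  under (suc n) = back -[1+ suc n ] (under n)

  integral : ℤ → A
  integral (+ n)    = forth n
  integral -[1+ n ] = under n

  integral-step : ∀ i → integral (i + 1ℤ) ≡ step i (integral i)
  integral-step (+ n) rewrite ℕ.+-comm n 1 = refl
  integral-step -[1+ zero ]  = sym (step-back _ _)
  integral-step -[1+ suc n ] = sym (step-back _ _)

-- Convexity keeps every unit step between a and b inside `Q`, where the local hypothesis applies.
constant-on-interval : ∀ {A : Set} (g : ℤ → A) (Q : ℤ → Set) →
  (∀ a b c → Q a → Q b → a ≤ c → c ≤ b → Q c) →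
  (∀ i → Q i → Q (i + 1ℤ) → g i ≡ g (i + 1ℤ)) →
  ∀ a b → Q a → Q b → g a ≡ g b
constant-on-interval g Q convex local a b qa qb =
  [ ascend a b qa qb , sym ∘ ascend b a qb qa ]′ (ℤ.≤-total a b)
  where
  walk : ∀ n a → Q a → Q (a + + n) → g a ≡ g (a + + n)
  walk zero    a qa qb rewrite ℤ.+-identityʳ a = refl
  walk (suc n) a qa qb rewrite sym (ℤ.+-assoc a 1ℤ (+ n)) =
    trans (local a qa qa′) (walk n (a + 1ℤ) qa′ qb)
    where qa′ = convex a _ (a + 1ℤ) qa qb (ℤ.i≤i+j a 1ℤ) (ℤ.i≤i+j (a + 1ℤ) (+ n))

  ascend : ∀ a b → Q a → Q b → a ≤ b → g a ≡ g b
  ascend a b qa qb a≤b = subst (λ c → g a ≡ g c) eq (walk ∣ b - a ∣ a qa (subst Q (sym eq) qb))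
    where
    eq : a + + ∣ b - a ∣ ≡ b
    eq = trans (cong (λ k → a + k) (ℤ.0≤i⇒+∣i∣≡i (ℤ.i≤j⇒0≤j-i a≤b)))
               (trans (sym (ℤ.+-assoc a b _)) (xyx⁻¹≈y a b))

-- Arithmetic modulo 3, where `rotate` adds 1 or -1

rotate : Bool → Fin 3 → Fin 3
rotate true  0F = 1F
rotate true  1F = 2F
rotate true  2F = 0F
rotate false 0F = 2F
rotate false 1F = 0F
rotate false 2F = 1F

rotate-inverse : ∀ s x → rotate s (rotate (not s) x) ≡ x
rotate-inverse true  0F = refl
rotate-inverse true  1F = refl
rotate-inverse true  2F = refl
rotate-inverse false 0F = refl
rotate-inverse false 1F = refl
rotate-inverse false 2F = refl

rotate-moves : ∀ s x → x ≢ rotate s x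
rotate-moves true  0F ()
rotate-moves true  1F ()
rotate-moves true  2F ()
rotate-moves false 0F ()
rotate-moves false 1F ()
rotate-moves false 2F ()

-- Modulo 3, twice a sign is the opposite sign.
rotate-twice : ∀ s x → rotate s (rotate s x) ≡ rotate (not s) x
rotate-twice true  0F = refl
rotate-twice true  1F = refl
rotate-twice true  2F = refl
rotate-twice false 0F = refl
rotate-twice false 1F = refl
rotate-twice false 2F = refl

_⊕_ : Fin 3 → Fin 3 → Fin 3
0F ⊕ y = y
1F ⊕ y = rotate true y
2F ⊕ y = rotate false y

rotate-⊕ˡ : ∀ s x y → rotate s x ⊕ y ≡ rotate s (x ⊕ y)
rotate-⊕ˡ true  0F y = refl
rotate-⊕ˡ true  1F y = sym (rotate-twice true y)
rotate-⊕ˡ true  2F y = sym (rotate-inverse true y)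
rotate-⊕ˡ false 0F y = refl
rotate-⊕ˡ false 1F y = sym (rotate-inverse false y)
rotate-⊕ˡ false 2F y = sym (rotate-twice false y)

⊕-comm : ∀ x y → x ⊕ y ≡ y ⊕ x
⊕-comm 0F 0F = refl
⊕-comm 0F 1F = refl
⊕-comm 0F 2F = refl
⊕-comm 1F 0F = refl
⊕-comm 1F 1F = refl
⊕-comm 1F 2F = refl
⊕-comm 2F 0F = refl
⊕-comm 2F 1F = refl
⊕-comm 2F 2F = refl

rotate-⊕ʳ : ∀ s x y → x ⊕ rotate s y ≡ rotate s (x ⊕ y)
rotate-⊕ʳ s x y = trans (⊕-comm x (rotate s y)) (trans (rotate-⊕ˡ s y x) (cong (rotate s) (⊕-comm y x)))

-- The colouring given by column and row signs

-- In a properly coloured cell opposite sides have the same colour increment, and the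
-- increments of its two directions agree exactly if the diagonal goes up to the right.
Separates : Polyomino → Triangulation → (ℤ → Bool) → (ℤ → Bool) → Set
Separates P t a b = ∀ {i j} → (i , j) ∈ cells P → t (i , j) ≡ not (a i xor b j)

module Colouring (a b : ℤ → Bool) where

  module H = Integral (rotate ∘ a) (rotate ∘ not ∘ a) (rotate-inverse ∘ a) 0F
  module V = Integral (rotate ∘ b) (rotate ∘ not ∘ b) (rotate-inverse ∘ b) 0F

  colour : Point → Fin 3
  colour (i , j) = H.integral i ⊕ V.integral j

  colour-right : ∀ i j → colour (i + 1ℤ , j) ≡ rotate (a i) (colour (i , j))
  colour-right i j = trans (cong (_⊕ V.integral j) (H.integral-step i)) (rotate-⊕ˡ (a i) _ _)

  colour-up : ∀ i j → colour (i , j + 1ℤ) ≡ rotate (b j) (colour (i , j))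
  colour-up i j = trans (cong (H.integral i ⊕_) (V.integral-step j)) (rotate-⊕ʳ (b j) (H.integral i) _)

  side-x : ∀ i j → colour (i , j) ≢ colour (i + 1ℤ , j)
  side-x i j eq = rotate-moves (a i) _ (trans eq (colour-right i j))

  side-y : ∀ i j → colour (i , j) ≢ colour (i , j + 1ℤ)
  side-y i j eq = rotate-moves (b j) _ (trans eq (colour-up i j))

  -- Two equal increments add up to the opposite one, which is not zero.
  colour-diag : ∀ i j → not (a i xor b j) ≡ true → colour (i , j) ≢ colour (i + 1ℤ , j + 1ℤ)
  colour-diag i j agree eq rewrite colour-up (i + 1ℤ) j | colour-right i j
    with a i | b j
  ... | true  | true  = rotate-moves false _ (trans eq (rotate-twice true _))
  ... | false | false = rotate-moves true _ (trans eq (rotate-twice false _))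

  -- The ends lie at opposite increments from (i , j), and c + 1 and c - 1 differ modulo 3.
  colour-anti : ∀ i j → not (a i xor b j) ≡ false → colour (i + 1ℤ , j) ≢ colour (i , j + 1ℤ)
  colour-anti i j differ eq rewrite colour-up i j | colour-right i j
    with a i | b j
  ... | true  | false = rotate-moves true _ (trans eq (sym (rotate-twice true _)))
  ... | false | true  = rotate-moves false _ (trans eq (sym (rotate-twice false _)))

  proper : ∀ {P t} → Separates P t a b → ∀ u v → Adj P t u v → colour u ≢ colour v
  proper sep _ _ ((i , j) , c∈P , bottom)  = side-x i j
  proper sep _ _ ((i , j) , c∈P , bottom') = ≢-sym (side-x i j)
  proper sep _ _ ((i , j) , c∈P , top)     = side-x i (j + 1ℤ)
  proper sep _ _ ((i , j) , c∈P , top')    = ≢-sym (side-x i (j + 1ℤ))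
  proper sep _ _ ((i , j) , c∈P , lside)   = side-y i j
  proper sep _ _ ((i , j) , c∈P , lside')  = ≢-sym (side-y i j)
  proper sep _ _ ((i , j) , c∈P , rside)   = side-y (i + 1ℤ) j
  proper sep _ _ ((i , j) , c∈P , rside')  = ≢-sym (side-y (i + 1ℤ) j)
  proper sep _ _ ((i , j) , c∈P , diag e)  = colour-diag i j (trans (sym (sep c∈P)) e)
  proper sep _ _ ((i , j) , c∈P , diag' e) = ≢-sym (colour-diag i j (trans (sym (sep c∈P)) e))
  proper sep _ _ ((i , j) , c∈P , anti e)  = colour-anti i j (trans (sym (sep c∈P)) e)
  proper sep _ _ ((i , j) , c∈P , anti' e) = ≢-sym (colour-anti i j (trans (sym (sep c∈P)) e))

-- Column and row signs from the parity condition and convexity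

module Separation (P : Polyomino) (convex : Convex P) (t : Triangulation)
  (even : ∀ {i j} → (i , j) ∈ cells P → (i + 1ℤ , j) ∈ cells P →
          (i , j + 1ℤ) ∈ cells P → (i + 1ℤ , j + 1ℤ) ∈ cells P →
          t (i , j) xor t (i + 1ℤ , j) ≡ t (i , j + 1ℤ) xor t (i + 1ℤ , j + 1ℤ)) where

  Domino : ℤ → ℤ → Set
  Domino i j = (i , j) ∈ cells P × (i + 1ℤ , j) ∈ cells P

  domino? : ∀ i → Dec (∃[ j ] Domino i j)
  domino? i = map′ (λ any → witness (find any)) (λ (j , p , q) → lose p (refl , q))
    (any? (λ (i′ , j) → (i′ ℤ.≟ i) ×-dec ((i + 1ℤ , j) ∈? cells P)) (cells P))
    where
    witness : (∃[ c ] c ∈ cells P × proj₁ c ≡ i × (i + 1ℤ , proj₂ c) ∈ cells P) → ∃[ j ] Domino i j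
    witness ((_ , j) , p , refl , q) = j , p , q

  row? : ∀ j → Dec (∃[ i ] (i , j) ∈ cells P)
  row? j = map′ (λ any → witness (find any)) (λ (i , p) → lose p refl) (any? (λ c → proj₂ c ℤ.≟ j) (cells P))
    where
    witness : (∃[ c ] c ∈ cells P × proj₂ c ≡ j) → ∃[ i ] (i , j) ∈ cells P
    witness ((i , _) , p , refl) = i , p

  flip : ℤ → Bool
  flip i with domino? i
  ... | yes (j , _) = t (i , j) xor t (i + 1ℤ , j)
  -- If the two columns share no row, no pair of cells constrains the value.
  ... | no _        = false

  -- By column convexity the rows meeting both columns form an interval, and `even` passes the
  -- difference from each row to the next.
  flip-domino : ∀ {i j} → Domino i j → flip i ≡ t (i , j) xor t (i + 1ℤ , j)
  flip-domino {i} {j} dom with domino? i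
  ... | no ¬dom = contradiction (j , dom) ¬dom
  ... | yes (j′ , dom′) = constant-on-interval (λ j → t (i , j) xor t (i + 1ℤ , j)) (Domino i)
          (λ j₁ j₂ j (p₁ , q₁) (p₂ , q₂) l u → proj₁ convex i j₁ j₂ j p₁ p₂ l u , proj₁ convex (i + 1ℤ) j₁ j₂ j q₁ q₂ l u)
          (λ j (p , q) (p′ , q′) → even p q p′ q′) j′ j dom′ dom

  -- The column signs. Adding a bit undoes itself, so it serves both as `step` and as `back`.
  module A = Integral (λ i s → s xor flip i) (λ i s → s xor flip i)
    (λ i s → trans (xor-assoc s _ _) (trans (cong (s xor_) (xor-same (flip i))) (xor-identityʳ s))) false

  -- The equation of `Separates`, solved for the row sign at one cell of the row.
  b : ℤ → Bool
  b j with row? j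
  ... | yes (i , _) = not (A.integral i xor t (i , j))
  ... | no _        = false

  -- A row is an interval by row convexity, and along it the column sign changes exactly when the
  -- diagonal does.
  row-constant : ∀ {i i′ j} → (i , j) ∈ cells P → (i′ , j) ∈ cells P →
                 A.integral i xor t (i , j) ≡ A.integral i′ xor t (i′ , j)
  row-constant {i} {i′} {j} = constant-on-interval (λ i → A.integral i xor t (i , j)) (λ i → (i , j) ∈ cells P)
    (proj₂ convex j) local i i′
    where
    local : ∀ i → (i , j) ∈ cells P → (i + 1ℤ , j) ∈ cells P →
            A.integral i xor t (i , j) ≡ A.integral (i + 1ℤ) xor t (i + 1ℤ , j)
    local i p q rewrite A.integral-step i | flip-domino (p , q) =
      solve 3 (λ a x y → a :+ x := (a :+ (x :+ y)) :+ y) refl (A.integral i) (t (i , j)) (t (i + 1ℤ , j))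
      where open xor-∧-Solver

  separates : Separates P t A.integral b
  separates {i} {j} c∈P with row? j
  ... | no ¬row = contradiction (i , c∈P) ¬row
  ... | yes (i′ , c′∈P) rewrite row-constant c′∈P c∈P =
    solve 2 (λ a x → x := con true :+ (a :+ (con true :+ (a :+ x)))) refl (A.integral i) (t (i , j))
    where open xor-∧-Solver

-- Factors of alternating lists and filters with one result

NoRepeat-++ˡ : ∀ {A : Set} (l : List A) {m} → NoRepeat (l ++ m) → NoRepeat l
NoRepeat-++ˡ []          nr        = []
NoRepeat-++ˡ (x ∷ [])    nr        = [ x ]
NoRepeat-++ˡ (x ∷ y ∷ l) (x≢y ∷ nr) = x≢y ∷ NoRepeat-++ˡ (y ∷ l) nr

NoRepeat-++ʳ : ∀ {A : Set} (l : List A) {m} → NoRepeat (l ++ m) → NoRepeat m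
NoRepeat-++ʳ []      nr = nr
NoRepeat-++ʳ (x ∷ l) nr = NoRepeat-++ʳ l (NoRepeat-tail nr)

filter-singleton : ∀ {A : Set} {Q : A → Set} (Q? : Decidable Q) {l x} → Unique l → x ∈ l → Q x →
                   (∀ {z} → z ∈ l → Q z → z ≡ x) → filter Q? l ≡ x ∷ []
filter-singleton Q? {y ∷ l} (y∉l ∷ _) (here refl) qx only =
  trans (filter-accept Q? qx)
    (cong (y ∷_) (filter-none Q? (All.tabulate λ z∈l qz → All.lookup y∉l z∈l (sym (only (there z∈l) qz)))))
filter-singleton Q? {y ∷ l} (y∉l ∷ l!) (there x∈l) qx only =
  trans (filter-reject Q? λ qy → All.lookup y∉l x∈l (only (here refl) qy))
    (filter-singleton Q? l! x∈l qx (only ∘ there))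

-- The word built for one vertex, by colours and roles

-- The role of a letter relative to the letter x that a word is built for: x itself,
-- a neighbour of x, or neither. Roles are numbers so that all? ranges over them.
Role : Set
Role = Fin 3

pattern self = 0F
pattern nbr  = 1F
pattern non  = 2F

Kind : Set
Kind = Fin 3 × Role

Layer : Set
Layer = Kind → Bool

all others nbrs nons : Fin 3 → Layer
all    k (c , _)    = Dec.does (c ≟ᶠ k)
others k (c , self) = false
others k (c , _)    = Dec.does (c ≟ᶠ k)
nbrs   k (c , nbr)  = Dec.does (c ≟ᶠ k)
nbrs   k (c , _)    = false
nons   k (c , non)  = Dec.does (c ≟ᶠ k)
nons   k (c , _)    = false

only : Layer
only (_ , self) = true
only (_ , _)    = false

-- The word 0 1 2 0 1 2 of colour classes, except that the letter x of colour k comes last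
-- in its class the first time and first the second time, and that its first occurrence is
-- moved past its non-neighbours in the next class.
layers : Fin 3 → List Layer
layers 0F = others 0F ∷ nons 1F ∷ only ∷ nbrs 1F ∷ all 2F ∷ only ∷ others 0F ∷ all 1F ∷ all 2F ∷ []
layers 1F = all 0F ∷ others 1F ∷ nons 2F ∷ only ∷ nbrs 2F ∷ all 0F ∷ only ∷ others 1F ∷ all 2F ∷ []
layers 2F = all 0F ∷ all 1F ∷ others 2F ∷ nons 0F ∷ only ∷ nbrs 0F ∷ all 1F ∷ only ∷ others 2F ∷ []

-- Reads Ls a b bs: a letter of kind a and one of kind b are met in the order bs (true for
-- the first letter), and never in the same layer.
Reads  : List Layer → Kind → Kind → List Bool → Set
Reads′ : Bool → Bool → List Layer → Kind → Kind → List Bool → Set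

Reads []       a b []      = ⊤
Reads []       a b (_ ∷ _) = ⊥
Reads (L ∷ Ls) a b bs      = Reads′ (L a) (L b) Ls a b bs

Reads′ false false Ls a b bs           = Reads Ls a b bs
Reads′ true  false Ls a b (true ∷ bs)  = Reads Ls a b bs
Reads′ false true  Ls a b (false ∷ bs) = Reads Ls a b bs
Reads′ _     _     Ls a b _            = ⊥

reads? : ∀ Ls a b bs → Dec (Reads Ls a b bs)
reads′? : ∀ p q Ls a b bs → Dec (Reads′ p q Ls a b bs)
reads? []       a b []      = yes tt
reads? []       a b (_ ∷ _) = no λ ()
reads? (L ∷ Ls) a b bs      = reads′? (L a) (L b) Ls a b bs
reads′? false false Ls a b bs           = reads? Ls a b bs
reads′? true  false Ls a b []           = no λ ()
reads′? true  false Ls a b (true ∷ bs)  = reads? Ls a b bs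
reads′? true  false Ls a b (false ∷ bs) = no λ ()
reads′? false true  Ls a b []           = no λ ()
reads′? false true  Ls a b (true ∷ bs)  = no λ ()
reads′? false true  Ls a b (false ∷ bs) = reads? Ls a b bs
reads′? true  true  Ls a b bs           = no λ ()

-- A constraint on the kinds of the ends of an edge that makes `reads-edge` a finite statement.
Compatible : Fin 3 → Kind → Kind → Set
Compatible k (c , r) (_ , r′) = r ≡ self → c ≡ k × r′ ≡ nbr

compatible? : ∀ k a b → Dec (Compatible k a b)
compatible? k (c , r) (_ , r′) = (r ≟ᶠ self) →-dec ((c ≟ᶠ k) ×-dec (r′ ≟ᶠ nbr))

abab : List Bool
abab = true ∷ false ∷ true ∷ false ∷ []

-- All combinations of colours and roles are checked by evaluating the decision procedure.
reads-edge : ∀ k c c′ r r′ → c < c′ → Compatible k (c , r) (c′ , r′) → Compatible k (c′ , r′) (c , r) →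
             Reads (layers k) (c , r) (c′ , r′) abab
reads-edge = toWitness
  {a? = all? λ k → all? λ c → all? λ c′ → all? λ r → all? λ r′ →
        (c <? c′) →-dec (compatible? k (c , r) (c′ , r′) →-dec
          (compatible? k (c′ , r′) (c , r) →-dec reads? (layers k) (c , r) (c′ , r′) abab))} tt

next : Fin 3 → Fin 3
next = rotate true

data Stutters : List Bool → Set where
  baab : Stutters (false ∷ true ∷ true ∷ false ∷ [])
  bbaa : Stutters (false ∷ false ∷ true ∷ true ∷ [])

reads-nonedge : ∀ k c → c ≡ k ⊎ c ≡ next k → ∃[ bs ] Stutters bs × Reads (layers k) (k , self) (c , non) bs
reads-nonedge 0F _ (inj₁ refl) = _ , baab , tt
reads-nonedge 1F _ (inj₁ refl) = _ , baab , tt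
reads-nonedge 2F _ (inj₁ refl) = _ , baab , tt
reads-nonedge 0F _ (inj₂ refl) = _ , baab , tt
reads-nonedge 1F _ (inj₂ refl) = _ , baab , tt
-- After class 2 comes class 0 of the second round, so both occurrences of b precede x.
reads-nonedge 2F _ (inj₂ refl) = _ , bbaa , tt

-- Hence for any two non-adjacent vertices the word of one of them spoils the alternation.
cyclic-order : ∀ c d → (d ≡ c ⊎ d ≡ next c) ⊎ (c ≡ next d)
cyclic-order 0F 0F = inj₁ (inj₁ refl)
cyclic-order 0F 1F = inj₁ (inj₂ refl)
cyclic-order 0F 2F = inj₂ refl
cyclic-order 1F 0F = inj₂ refl
cyclic-order 1F 1F = inj₁ (inj₁ refl)
cyclic-order 1F 2F = inj₁ (inj₂ refl)
cyclic-order 2F 0F = inj₁ (inj₂ refl)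
cyclic-order 2F 1F = inj₂ refl
cyclic-order 2F 2F = inj₁ (inj₁ refl)

only∈layers : ∀ k → only ∈ layers k
only∈layers 0F = there (there (here refl))
only∈layers 1F = there (there (there (here refl)))
only∈layers 2F = there (there (there (there (here refl))))

-- Decidability of adjacency

corners : Cell → List Point
corners (i , j) = (i , j) ∷ (i + 1ℤ , j) ∷ (i , j + 1ℤ) ∷ (i + 1ℤ , j + 1ℤ) ∷ []

corners⁺ : ∀ {c v} → Corner c v → v ∈ corners c
corners⁺ ll = here refl
corners⁺ lr = there (here refl)
corners⁺ ul = there (there (here refl))
corners⁺ ur = there (there (there (here refl)))

corners⁻ : ∀ c {v} → v ∈ corners c → Corner c v
corners⁻ c (here refl)                         = ll
corners⁻ c (there (here refl))                 = lr
corners⁻ c (there (there (here refl)))         = ul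
corners⁻ c (there (there (there (here refl)))) = ur

diagonal : Bool → Cell → List (Point × Point)
diagonal true  (i , j) = ((i , j) , (i + 1ℤ , j + 1ℤ)) ∷ ((i + 1ℤ , j + 1ℤ) , (i , j)) ∷ []
diagonal false (i , j) = ((i + 1ℤ , j) , (i , j + 1ℤ)) ∷ ((i , j + 1ℤ) , (i + 1ℤ , j)) ∷ []

sides : Cell → List (Point × Point)
sides (i , j) =
  ((i , j) , (i + 1ℤ , j)) ∷ ((i + 1ℤ , j) , (i , j)) ∷
  ((i , j + 1ℤ) , (i + 1ℤ , j + 1ℤ)) ∷ ((i + 1ℤ , j + 1ℤ) , (i , j + 1ℤ)) ∷
  ((i , j) , (i , j + 1ℤ)) ∷ ((i , j + 1ℤ) , (i , j)) ∷
  ((i + 1ℤ , j) , (i + 1ℤ , j + 1ℤ)) ∷ ((i + 1ℤ , j + 1ℤ) , (i + 1ℤ , j)) ∷ []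

-- The pair is looked up in a list, since given points cannot be matched against indices such as
-- `i + 1ℤ`.
cellEdge? : ∀ t c u v → Dec (CellEdge t c u v)
cellEdge? t c u v = map′ [ side⁻ , diagonal⁻ (t c) refl ]′ split
  (((u , v) ∈ᵉ? sides c) ⊎-dec ((u , v) ∈ᵉ? diagonal (t c) c))
  where
  side⁻ : ∀ {c u v} → (u , v) ∈ sides c → CellEdge t c u v
  side⁻ (here refl)                                                           = bottom
  side⁻ (there (here refl))                                                   = bottom'
  side⁻ (there (there (here refl)))                                           = top
  side⁻ (there (there (there (here refl))))                                   = top'
  side⁻ (there (there (there (there (here refl)))))                           = lside
  side⁻ (there (there (there (there (there (here refl))))))                   = lside'
  side⁻ (there (there (there (there (there (there (here refl)))))))           = rside
  side⁻ (there (there (there (there (there (there (there (here refl))))))))   = rside'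

  diagonal⁻ : ∀ b {c u v} → t c ≡ b → (u , v) ∈ diagonal b c → CellEdge t c u v
  diagonal⁻ true  e (here refl)         = diag e
  diagonal⁻ true  e (there (here refl)) = diag' e
  diagonal⁻ false e (here refl)         = anti e
  diagonal⁻ false e (there (here refl)) = anti' e

  split : ∀ {c u v} → CellEdge t c u v → (u , v) ∈ sides c ⊎ (u , v) ∈ diagonal (t c) c
  split bottom    = inj₁ (here refl)
  split bottom'   = inj₁ (there (here refl))
  split top       = inj₁ (there (there (here refl)))
  split top'      = inj₁ (there (there (there (here refl))))
  split lside     = inj₁ (there (there (there (there (here refl)))))
  split lside'    = inj₁ (there (there (there (there (there (here refl))))))
  split rside     = inj₁ (there (there (there (there (there (there (here refl)))))))
  split rside'    = inj₁ (there (there (there (there (there (there (there (here refl))))))))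
  split (diag e)  rewrite e = inj₂ (here refl)
  split (diag' e) rewrite e = inj₂ (there (here refl))
  split (anti e)  rewrite e = inj₂ (here refl)
  split (anti' e) rewrite e = inj₂ (there (here refl))

-- The word of a 3-coloured triangulation

module Word (P : Polyomino) (t : Triangulation) (f : Point → Fin 3)
  (proper : ∀ u v → Adj P t u v → f u ≢ f v) where

  open Adjacency P t

  adj? : ∀ u v → Dec (Adj P t u v)
  adj? u v = map′ find (λ (c , c∈P , e) → lose c∈P e) (any? (λ c → cellEdge? t c u v) (cells P))

  vertices : List Point
  vertices = deduplicate _≟P_ (concatMap corners (cells P))

  vertices! : Unique vertices
  vertices! = deduplicate-! _

  ∈-vertices : ∀ {v} → IsVertex P v → v ∈ vertices
  ∈-vertices (c , c∈P , corner) = ∈-deduplicate⁺ _≟P_ (∈-concatMap⁺ corners (lose c∈P (corners⁺ corner)))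

  vertex : ∀ {v} → v ∈ vertices → IsVertex P v
  vertex v∈ with c , c∈P , v∈c ← find (∈-concatMap⁻ corners (∈-deduplicate⁻ _≟P_ _ v∈)) = c , c∈P , corners⁻ c v∈c

  role : Point → Point → Role
  role x z with z ≟P x
  ... | yes _ = self
  ... | no _ with adj? z x
  ...   | yes _ = nbr
  ...   | no _  = non

  role-self : ∀ x → role x x ≡ self
  role-self x with x ≟P x
  ... | yes _  = refl
  ... | no x≢x = contradiction refl x≢x

  role-self⁻ : ∀ {x z} → role x z ≡ self → z ≡ x
  role-self⁻ {x} {z} eq with z ≟P x
  ... | yes z≡x = z≡x
  ... | no _ with adj? z x
  role-self⁻ () | no _ | yes _
  role-self⁻ () | no _ | no _

  role-nbr : ∀ {x z} → Adj P t z x → role x z ≡ nbr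
  role-nbr {x} {z} zx with z ≟P x
  ... | yes z≡x = contradiction z≡x (Adj-irrefl zx)
  ... | no _ with adj? z x
  ...   | yes _  = refl
  ...   | no ¬zx = contradiction zx ¬zx

  role-non : ∀ {x z} → Apart z x → role x z ≡ non
  role-non {x} {z} (z≢x , ¬zx) with z ≟P x
  ... | yes z≡x = contradiction z≡x z≢x
  ... | no _ with adj? z x
  ...   | yes zx = contradiction zx ¬zx
  ...   | no _   = refl

  kind : Point → Point → Kind
  kind x z = f z , role x z

  layer : Point → Layer → List Point
  layer x L = filter (λ z → T? (L (kind x z))) vertices

  word : Point → List Point
  word x = concatMap (layer x) (layers (f x))

  letters : Point → Point → List Bool → List Point
  letters a b = map (λ s → if s then a else b)

  restrict-++ : ∀ l m a b → restrict (l ++ m) a b ≡ restrict l a b ++ restrict m a b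
  restrict-++ l m a b = filter-++ _ l m

  restrict-layer-one : ∀ x {a b} L → a ∈ vertices → T (L (kind x a)) → ¬ T (L (kind x b)) →
                       restrict (layer x L) a b ≡ a ∷ []
  restrict-layer-one x {a} {b} L a∈V La ¬Lb = filter-singleton _ (filter⁺ _ vertices!)
    (∈-filter⁺ _ a∈V La) (inj₁ refl)
    λ { z∈ (inj₁ z≡a) → z≡a
      ; z∈ (inj₂ refl) → contradiction (proj₂ (∈-filter⁻ (λ z → T? (L (kind x z))) {xs = vertices} z∈)) ¬Lb }

  restrict-layer-none : ∀ x {a b} L → ¬ T (L (kind x a)) → ¬ T (L (kind x b)) →
                        restrict (layer x L) a b ≡ []
  restrict-layer-none x {a} {b} L ¬La ¬Lb = filter-none (λ z → (z ≟P a) ⊎-dec (z ≟P b)) (All.tabulate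
    λ { z∈ (inj₁ refl) → ¬La (proj₂ (∈-filter⁻ (λ z → T? (L (kind x z))) {xs = vertices} z∈))
      ; z∈ (inj₂ refl) → ¬Lb (proj₂ (∈-filter⁻ (λ z → T? (L (kind x z))) {xs = vertices} z∈)) })

  -- `Reads` never puts both letters into one layer, and a layer has no repetitions, so the kinds
  -- alone determine the restriction.
  restrict-reads : ∀ x {a b} → a ∈ vertices → b ∈ vertices → ∀ Ls bs → Reads Ls (kind x a) (kind x b) bs →
                   restrict (concatMap (layer x) Ls) a b ≡ letters a b bs
  restrict-reads x a∈V b∈V []       []       _ = refl
  restrict-reads x {a} {b} a∈V b∈V (L ∷ Ls) bs reads
    rewrite restrict-++ (layer x L) (concatMap (layer x) Ls) a b
    with L (kind x a) in La | L (kind x b) in Lb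
  restrict-reads x {a} {b} a∈V b∈V (L ∷ Ls) bs reads | false | false =
    -- `T false` is empty, so transport along `La` or `Lb` is itself the refutation.
    cong₂ _++_ (restrict-layer-none x L (subst T La) (subst T Lb)) (restrict-reads x a∈V b∈V Ls bs reads)
  restrict-reads x {a} {b} a∈V b∈V (L ∷ Ls) (true ∷ bs) reads | true | false =
    cong₂ _++_ (restrict-layer-one x L a∈V (subst T (sym La) tt) (subst T Lb)) (restrict-reads x a∈V b∈V Ls bs reads)
  restrict-reads x {a} {b} a∈V b∈V (L ∷ Ls) (false ∷ bs) reads | false | true =
    cong₂ _++_ (trans (restrict-sym (layer x L) a b) (restrict-layer-one x L b∈V (subst T (sym Lb) tt) (subst T La)))
      (restrict-reads x a∈V b∈V Ls bs reads)

  w : List Point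
  w = concatMap word vertices

  compatible : ∀ x {a b} → Adj P t a b → Compatible (f x) (kind x a) (kind x b)
  compatible x {a} ab ra with refl ← role-self⁻ {x} {a} ra = refl , role-nbr (Adj-sym ab)

  edge-word : ∀ x {a b} → Adj P t a b → f a < f b → restrict (word x) a b ≡ letters a b abab
  edge-word x {a} {b} ab fa<fb = restrict-reads x (∈-vertices (Adj-vertex ab)) (∈-vertices (Adj-vertex (Adj-sym ab)))
    (layers (f x)) abab
    (reads-edge (f x) (f a) (f b) (role x a) (role x b) fa<fb (compatible x ab) (compatible x (Adj-sym ab)))

  -- Every factor abab begins with a and ends with b; the b in front lets consecutive factors be
  -- joined.
  edge-words : ∀ xs {a b} → Adj P t a b → f a < f b → NoRepeat (b ∷ restrict (concatMap word xs) a b)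
  edge-words []       ab fa<fb = [ _ ]
  edge-words (x ∷ xs) {a} {b} ab fa<fb
    rewrite restrict-++ (word x) (concatMap word xs) a b | edge-word x ab fa<fb =
    ≢-sym a≢b ∷ a≢b ∷ ≢-sym a≢b ∷ a≢b ∷ edge-words xs ab fa<fb
    where a≢b = Adj-irrefl ab

  edge-alternates : ∀ {a b} → Adj P t a b → Alternate w a b
  edge-alternates {a} {b} ab with <-cmp (f a) (f b)
  ... | tri< fa<fb _ _ = NoRepeat-tail (edge-words vertices ab fa<fb)
  ... | tri≈ _ fa≡fb _ = contradiction fa≡fb (proper a b ab)
  ... | tri> _ _ fb<fa = subst NoRepeat (restrict-sym w b a) (NoRepeat-tail (edge-words vertices (Adj-sym ab) fb<fa))

  -- `word x` is a factor of `w`, and restriction respects factors.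
  Alternate-word : ∀ {x a b} → x ∈ vertices → Alternate w a b → Alternate (word x) a b
  Alternate-word {x} {a} {b} x∈V nr with ys , zs , eq ← ∈-∃++ x∈V =
    NoRepeat-++ˡ _ (subst NoRepeat (restrict-++ (word x) (concatMap word zs) a b)
      (NoRepeat-++ʳ (restrict (concatMap word ys) a b)
        (subst NoRepeat (trans (cong (λ u → restrict u a b) (trans (cong (concatMap word) eq) (concatMap-++ word ys _)))
                               (restrict-++ (concatMap word ys) _ a b)) nr)))

  stutters : ∀ {a b bs} → Stutters bs → ¬ NoRepeat (letters a b bs)
  stutters baab (_ ∷ a≢a ∷ _) = a≢a refl
  stutters bbaa (b≢b ∷ _)     = b≢b refl

  nonedge : ∀ {a b} → a ∈ vertices → b ∈ vertices → Apart a b → f b ≡ f a ⊎ f b ≡ next (f a) → ¬ Alternate w a b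
  nonedge {a} {b} a∈V b∈V ab cs nr with bs , st , reads ← reads-nonedge (f a) (f b) cs =
    stutters st (subst NoRepeat
      (restrict-reads a a∈V b∈V (layers (f a)) bs
        (subst₂ (λ r r′ → Reads (layers (f a)) (f a , r) (f b , r′) bs)
          (sym (role-self a)) (sym (role-non (Apart-sym ab))) reads))
      (Alternate-word a∈V nr))

  alternates-edge : ∀ {a b} → a ∈ vertices → b ∈ vertices → a ≢ b → Alternate w a b → Adj P t a b
  alternates-edge {a} {b} a∈V b∈V a≢b nr with adj? a b
  ... | yes ab = ab
  ... | no ¬ab with cyclic-order (f a) (f b)
  ...   | inj₁ cs = contradiction nr (nonedge a∈V b∈V (a≢b , ¬ab) cs)
  ...   | inj₂ c  = contradiction (subst NoRepeat (restrict-sym w a b) nr)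
                      (nonedge b∈V a∈V (Apart-sym (a≢b , ¬ab)) (inj₂ c))

  w-vertex : ∀ {v} → v ∈ w → IsVertex P v
  w-vertex v∈w with x , _ , v∈x ← find (∈-concatMap⁻ word {xs = vertices} v∈w)
               with L , _ , v∈L ← find (∈-concatMap⁻ (layer x) {xs = layers (f x)} v∈x)
    = vertex (proj₁ (∈-filter⁻ (λ z → T? (L (kind x z))) v∈L))

  vertex∈w : ∀ v → IsVertex P v → v ∈ w
  vertex∈w v v∈P = ∈-concatMap⁺ word (lose v∈V
    (∈-concatMap⁺ (layer v) (lose (only∈layers (f v))
      (∈-filter⁺ (λ z → T? (only (kind v z))) v∈V (subst (λ r → T (only (f v , r))) (sym (role-self v)) tt)))))
    where v∈V = ∈-vertices v∈P

  represents : Represents P t w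
  represents = All.tabulate w-vertex , vertex∈w ,
    λ x y x∈P y∈P x≢y → mk⇔ (alternates-edge (∈-vertices x∈P) (∈-vertices y∈P) x≢y) edge-alternates

theorem3 : (P : Polyomino) → Convex P → (t : Triangulation) →
    WordRepresentable P t ⇔ ThreeColorable P t
theorem3 P convex t = mk⇔ to from
  where
  to : WordRepresentable P t → ThreeColorable P t
  to (w , rep) = colour , proper {P} {t} separates
    where
    open Separation P convex t (λ sw se nw ne → Block.even {P} {t} rep sw se nw ne)
    open Colouring A.integral b

  from : ThreeColorable P t → WordRepresentable P t
  from (f , proper) = Word.w P t f proper , Word.represents P t f proper
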